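{- For each $n\ge1$, the map $\Phi:\operatorname{Sort}_n(\operatorname{SC}_{132})\to\mathbf D_n$ is a bijection. Consequently, $|\operatorname{Sort}_n(\operatorname{SC}_{132})|=C_n=\frac{1}{n+1}\binom{2n}{n}$.
   Context: $S_n$ is the set of permutations of $[n]$ in one-line notation. Two sequences of distinct integers have the same relative order if replacing the $i$th smallest entry of each by $i$ yields the same word; a permutation contains $\sigma$ classically (resp. consecutively) if some subsequence (resp. consecutive subsequence) has the same relative order as $\sigma$, and avoids it otherwise. $\operatorname{SC}_{132}:S_n\to S_n$ sends a permutation through a stack: at each step, if there is a next input entry and placing it on top of the stack would make the stack contents, read top to bottom, avoid $132$ consecutively, push it; otherwise pop the top entry of the stack to the end of the output; stop when the output has length $n$. $\operatorname{Sort}_n(\operatorname{SC}_{132})$ is the set of $\pi\in S_n$ such that $\operatorname{SC}_{132}(\pi)$ avoids $231$ classically. $\mathbf D_n$ is the set of Dyck paths of semilength $n$: words over $\{U,D\}$ with $n$ copies of each letter such that every prefix has at least as many $U$'s as $D$'s. For $\pi\in\operatorname{Sort}_n(\operatorname{SC}_{132})$, write $\pi=a_1\cdots a_k$ where $a_1,\dots,a_k$ are its ascending runs (maximal consecutive increasing subsequences), let $m_i$ be the first entry of $a_i$, set $m_0=n+1$, and define $\Phi(\pi)=U^{m_0-m_1}D^{|a_1|}U^{m_1-m_2}D^{|a_2|}\cdots U^{m_{k-1}-m_k}D^{|a_k|}$. -}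

module Defs where

open import Data.Bool using (Bool; true; false; _∧_; _∨_; not; T; if_then_else_)
open import Data.Nat using (ℕ; zero; suc; _+_; _*_; _∸_; _<ᵇ_; _≡ᵇ_; _/_)
open import Data.Nat.Combinatorics using (_C_)
open import Data.List using (List; []; _∷_; length; reverse; replicate; _++_)
open import Data.Bool.ListAction using (all; any)
open import Data.Maybe using (Maybe; just; nothing)
open import Data.Product using (Σ)

elemᵇ : ℕ → List ℕ → Bool
elemᵇ x [] = false
elemᵇ x (y ∷ ys) = (x ≡ᵇ y) ∨ elemᵇ x ys

distinctᵇ : List ℕ → Bool
distinctᵇ [] = true
distinctᵇ (x ∷ xs) = not (elemᵇ x xs) ∧ distinctᵇ xs

isPermᵇ : ℕ → List ℕ → Bool
isPermᵇ n π = (length π ≡ᵇ n) ∧ all (λ x → (0 <ᵇ x) ∧ (x <ᵇ suc n)) π ∧ distinctᵇ π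

contains132-consᵇ : List ℕ → Bool
contains132-consᵇ (x ∷ y ∷ z ∷ rest) =
  ((x <ᵇ z) ∧ (z <ᵇ y)) ∨ contains132-consᵇ (y ∷ z ∷ rest)
contains132-consᵇ _ = false

private
  anyLess : ℕ → List ℕ → Bool
  anyLess a = any (λ z → z <ᵇ a)

  find31 : ℕ → List ℕ → Bool
  find31 a [] = false
  find31 a (y ∷ ys) = ((a <ᵇ y) ∧ anyLess a ys) ∨ find31 a ys

contains231ᵇ : List ℕ → Bool
contains231ᵇ [] = false
contains231ᵇ (x ∷ xs) = find31 x xs ∨ contains231ᵇ xs

-- The pattern-avoiding stack map SC_132.
-- The stack is a list whose head is the top, so the stack read top to
-- bottom is the list itself.  The output is accumulated in reverse.
-- Each entry is pushed once and popped once, so 2n steps always suffice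
-- for the run to reach an output of length n; the fuel only ensures
-- structural termination.

scLoop : ℕ → List ℕ → List ℕ → List ℕ → List ℕ
scLoop zero input stack revOut = reverse revOut
scLoop (suc k) [] [] revOut = reverse revOut
scLoop (suc k) (a ∷ input) stack revOut =
  if not (contains132-consᵇ (a ∷ stack))
  then scLoop k input (a ∷ stack) revOut
  else (popStep stack)
  where
  popStep : List ℕ → List ℕ
  popStep [] = reverse revOut   -- unreachable (a one-element stack avoids 132)
  popStep (t ∷ s) = scLoop k (a ∷ input) s (t ∷ revOut)
scLoop (suc k) [] (t ∷ s) revOut = scLoop k [] s (t ∷ revOut)

SC132 : List ℕ → List ℕ
SC132 π = scLoop (2 * length π) π [] []

inSortᵇ : ℕ → List ℕ → Bool
inSortᵇ n π = isPermᵇ n π ∧ not (contains231ᵇ (SC132 π))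

SortSC132 : ℕ → Set
SortSC132 n = Σ (List ℕ) (λ π → T (inSortᵇ n π))

data Step : Set where
  U D : Step

dyckFromᵇ : ℕ → List Step → Bool
dyckFromᵇ zero [] = true
dyckFromᵇ (suc h) [] = false
dyckFromᵇ h (U ∷ w) = dyckFromᵇ (suc h) w
dyckFromᵇ zero (D ∷ w) = false
dyckFromᵇ (suc h) (D ∷ w) = dyckFromᵇ h w

countU : List Step → ℕ
countU [] = 0
countU (U ∷ w) = suc (countU w)
countU (D ∷ w) = countU w

isDyckᵇ : ℕ → List Step → Bool
isDyckᵇ n w = dyckFromᵇ 0 w ∧ (countU w ≡ᵇ n)

DyckPaths : ℕ → Set
DyckPaths n = Σ (List Step) (λ w → T (isDyckᵇ n w))

ascRuns : List ℕ → List (List ℕ)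
ascRuns [] = []
ascRuns (x ∷ xs) = go x [] xs
  where
  go : ℕ → List ℕ → List ℕ → List (List ℕ)
  go cur acc [] = reverse (cur ∷ acc) ∷ []
  go cur acc (y ∷ ys) =
    if cur <ᵇ y then go y (cur ∷ acc) ys
    else reverse (cur ∷ acc) ∷ go y [] ys

-- Φ with m₀ = n+1.  Φ is only defined when every exponent m_{i-1} - m_i is a
-- natural number (m_{i-1} ≥ m_i); otherwise we return nothing.
ΦRuns : ℕ → List (List ℕ) → Maybe (List Step)
ΦRuns prev [] = just []
ΦRuns prev ([] ∷ rs) = nothing    -- runs are never empty
ΦRuns prev ((m ∷ a) ∷ rs) with m <ᵇ suc prev
... | false = nothing
... | true with ΦRuns m rs
...   | nothing = nothing
...   | just w = just (replicate (prev ∸ m) U ++ replicate (length (m ∷ a)) D ++ w)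

Φ : ℕ → List ℕ → Maybe (List Step)
Φ n π = ΦRuns (suc n) (ascRuns π)

catalan : ℕ → ℕ
catalan n = ((2 * n) C n) / suc n

module Submission where

open import Defs
open import Data.Bool using (Bool; true; false; T; _∧_; _∨_; not; if_then_else_)
open import Data.Bool.ListAction using (all; any)
open import Data.Bool.Properties using (T-irrelevant; T-∧; T-∨; T-≡; ∧-zeroʳ)
open import Data.Empty using (⊥-elim)
open import Data.Fin using (Fin; zero; suc)
open import Data.Fin.Properties using (+↔⊎)
open import Data.List using (List; []; _∷_; [_]; _++_; _∷ʳ_; reverse; map; concatMap; length; replicate)
open import Data.List.Membership.Propositional using (_∈_; _∉_; find; lose)
open import Data.List.Membership.Propositional.Properties using (∈-++⁻; ∈-++⁺ˡ; ∈-++⁺ʳ; ∈-∃++)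
open import Data.List.Properties using (++-assoc; ++-identityʳ; length-++; length-reverse; reverse-++; unfold-reverse)
open import Data.List.Relation.Binary.Permutation.Propositional
  using (_↭_; prep; ↭-refl; ↭-sym; ↭-trans; ↭⇒↭ₛ)
open import Data.List.Relation.Binary.Permutation.Propositional.Properties
  using (∈-resp-↭; All-resp-↭; ↭-length; ↭-reverse; ¬x∷xs↭[]; drop-∷; drop-mid; shift; shifts)
  renaming (++⁺ˡ to ↭-++⁺ˡ; ++⁺ʳ to ↭-++⁺ʳ)
import Data.List.Relation.Binary.Permutation.Setoid.Properties as Permutationₛ
open import Data.List.Relation.Binary.Sublist.Propositional
  using (_⊆_; []; _∷_; ⊆-refl; ⊆-trans; minimum; from∈; to∈) renaming (_∷ʳ_ to skip)
open import Data.List.Relation.Binary.Sublist.Propositional.Properties using (++⁺; ++⁺ˡ; All-resp-⊆)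
open import Data.List.Relation.Unary.All as All using (All; []; _∷_)
import Data.List.Relation.Unary.All.Properties as Allₚ
open import Data.List.Relation.Unary.AllPairs as AllPairs using (AllPairs; []; _∷_)
import Data.List.Relation.Unary.AllPairs.Properties as AllPairsₚ
open import Data.List.Relation.Unary.Any using (here; there)
open import Data.List.Relation.Unary.Any.Properties using (any⁺; any⁻)
open import Data.List.Relation.Unary.Unique.Propositional using (Unique)
open import Data.Maybe using (just)
open import Data.Maybe.Properties using (just-injective)
open import Data.Nat using (ℕ; zero; suc; _+_; _*_; _∸_; _/_; _≡ᵇ_; _<ᵇ_; _<_; _>_; _≤_; s≤s)
open import Data.Nat.Combinatorics using (_C_; nC1≡n; nCk+nC[k+1]≡[n+1]C[k+1]; nCk≡nC[n∸k])
open import Data.Nat.DivMod using (m*n/n≡m)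
open import Data.Nat.Properties
open import Data.Nat.Tactic.RingSolver using (solve-∀)
open import Data.Product using (Σ; Σ-syntax; ∃-syntax; _×_; _,_; proj₁; proj₂)
open import Data.Sum using (_⊎_; inj₁; inj₂)
open import Data.Sum.Function.Propositional using (_⊎-↔_)
open import Function using (_∘_)
open import Function.Bundles using (_↔_; mk↔ₛ′; mk⤖; module Equivalence)
open import Function.Construct.Composition using (_↔-∘_)
open import Function.Construct.Symmetry using (↔-sym)
open import Function.Definitions using (Bijective)
open import Function.Properties.Bijection using (⤖⇒↔)
open import Relation.Binary.Definitions using (tri<; tri≈; tri>)
open import Relation.Binary.PropositionalEquality hiding ([_])
open import Relation.Nullary using (¬_; contradiction)

-- A canonical permutation has decreasing run minima, and the entries that are
-- not run minima, read run by run and downwards inside each run, decrease too.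
-- On a permutation with decreasing run minima, SC_132 releases exactly these
-- other entries in that order and then the minima in increasing order, so its
-- output avoids 231 iff the other entries decrease.  If a run minimum m is
-- followed by a larger one a, then a stays on the stack above some x > a whose
-- lower neighbour y is < a, and a x y survives in the output as a 231.
-- A canonical permutation is rebuilt from its Dyck word by a queue: the U's
-- introduce n, n - 1, ..., a U before a D introduces a run minimum, the other
-- values wait in the queue and every remaining D takes its front.  The D's never
-- empty the queue prematurely exactly because the word is a Dyck word.

-- Counting Dyck paths

Σ-T-≡ : {A : Set} {P : A → Bool} {x y : Σ A (λ a → T (P a))} → proj₁ x ≡ proj₁ y → x ≡ y
Σ-T-≡ refl = cong (_ ,_) (T-irrelevant _ _)

T-∧⁻ : ∀ {x y} → T (x ∧ y) → T x × T y
T-∧⁻ = Equivalence.to T-∧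

T-∧⁺ : ∀ {x y} → T x → T y → T (x ∧ y)
T-∧⁺ p q = Equivalence.from T-∧ (p , q)

Paths : ℕ → ℕ → Set
Paths h v = Σ[ w ∈ List Step ] T (dyckFromᵇ h w ∧ (countU w ≡ᵇ v))

-- Ballot numbers, split by first letter. The recursion is lexicographic: a `U` lowers `v` although
-- it raises `h`, and a `D` lowers `h` at fixed `v`.
ballot : ℕ → ℕ → ℕ
ballot zero    zero    = 1
ballot (suc h) zero    = ballot h 0
ballot zero    (suc v) = ballot 1 v
ballot (suc h) (suc v) = ballot (suc (suc h)) v + ballot h (suc v)

Paths-0-0 : Paths 0 0 ↔ Fin 1
Paths-0-0 = mk↔ₛ′ (λ _ → zero) (λ _ → [] , _) (λ { zero → refl })
  λ { ([] , _) → refl ; (U ∷ w , p) → ⊥-elim (proj₂ (T-∧⁻ {dyckFromᵇ 1 w} p)) }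

Paths-D : ∀ h → Paths (suc h) 0 ↔ Paths h 0
Paths-D h = mk↔ₛ′ to (λ { (w , p) → D ∷ w , p }) (λ _ → refl) from-to
  where
  to : Paths (suc h) 0 → Paths h 0
  to (U ∷ w , p) = ⊥-elim (proj₂ (T-∧⁻ {dyckFromᵇ (suc (suc h)) w} p))
  to (D ∷ w , p) = w , p
  from-to : ∀ p → (D ∷ proj₁ (to p) , proj₂ (to p)) ≡ p
  from-to (U ∷ w , p) = ⊥-elim (proj₂ (T-∧⁻ {dyckFromᵇ (suc (suc h)) w} p))
  from-to (D ∷ w , p) = refl

Paths-U : ∀ v → Paths 0 (suc v) ↔ Paths 1 v
Paths-U v = mk↔ₛ′ (λ { (U ∷ w , p) → w , p }) (λ { (w , p) → U ∷ w , p })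
  (λ _ → refl) (λ { (U ∷ w , p) → refl })

Paths-UD : ∀ h v → Paths (suc h) (suc v) ↔ (Paths (suc (suc h)) v ⊎ Paths h (suc v))
Paths-UD h v = mk↔ₛ′
  (λ { (U ∷ w , p) → inj₁ (w , p) ; (D ∷ w , p) → inj₂ (w , p) })
  (λ { (inj₁ (w , p)) → U ∷ w , p ; (inj₂ (w , p)) → D ∷ w , p })
  (λ { (inj₁ _) → refl ; (inj₂ _) → refl })
  (λ { (U ∷ w , p) → refl ; (D ∷ w , p) → refl })

Paths↔Fin : ∀ h v → Paths h v ↔ Fin (ballot h v)
Paths↔Fin zero    zero    = Paths-0-0
Paths↔Fin (suc h) zero    = Paths↔Fin h 0 ↔-∘ Paths-D h
Paths↔Fin zero    (suc v) = Paths↔Fin 1 v ↔-∘ Paths-U v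
Paths↔Fin (suc h) (suc v) = ↔-sym +↔⊎
  ↔-∘ ((Paths↔Fin (suc (suc h)) v ⊎-↔ Paths↔Fin h (suc v)) ↔-∘ Paths-UD h v)

ballot-0 : ∀ h → ballot h 0 ≡ 1
ballot-0 zero    = refl
ballot-0 (suc h) = ballot-0 h

C-sym : ∀ v → suc (v + v) C v ≡ suc (v + v) C suc v
C-sym v = trans (nCk≡nC[n∸k] (m≤n⇒m≤1+n (m≤m+n v v)))
  (cong (suc (v + v) C_) (trans (+-∸-assoc 1 (m≤m+n v v)) (cong suc (m+n∸m≡n v v))))

-- By reflection, (2v + 2 + h) C v counts the words from height h that go below 0.
ballot-C : ∀ h v → ballot h (suc v) + (suc v + suc v + h) C v ≡ (suc v + suc v + h) C suc v
ballot-C zero v = subst (λ k → ballot 1 v + k C v ≡ k C suc v) (N v) (go v)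
  where
  N : ∀ v → suc (suc (v + v)) ≡ suc v + suc v + 0
  N = solve-∀
  M : ∀ v → suc v + suc v + 1 ≡ suc (suc v + suc v)
  M = solve-∀
  go : ∀ v → ballot 1 v + suc (suc (v + v)) C v ≡ suc (suc (v + v)) C suc v
  go zero    = refl
  -- At height 0 only `U` is possible, so the ballot recursion has one summand for two Pascal
  -- summands. The odd row `K` makes up for the other one: its two middle coefficients agree.
  go (suc v) = begin
    ballot 1 (suc v) + suc K C suc v        ≡⟨ cong (ballot 1 (suc v) +_) (nCk+nC[k+1]≡[n+1]C[k+1] K v) ⟨
    ballot 1 (suc v) + (K C v + K C suc v)  ≡⟨ +-assoc (ballot 1 (suc v)) _ _ ⟨
    ballot 1 (suc v) + K C v + K C suc v    ≡⟨ cong (_+ K C suc v) (subst (λ k → ballot 1 (suc v) + k C v ≡ k C suc v) (M v) (ballot-C 1 v)) ⟩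
    K C suc v + K C suc v                   ≡⟨ cong (K C suc v +_) (C-sym (suc v)) ⟩
    K C suc v + K C suc (suc v)             ≡⟨ nCk+nC[k+1]≡[n+1]C[k+1] K (suc v) ⟩
    suc K C suc (suc v)                     ∎
    where
    open ≡-Reasoning
    K = suc (suc v + suc v)
ballot-C (suc h) zero = begin
  ballot h 0 + ballot h 1 + 1  ≡⟨ cong (λ b → b + ballot h 1 + 1) (ballot-0 h) ⟩
  suc (ballot h 1 + 1)         ≡⟨ cong suc (ballot-C h 0) ⟩
  suc ((2 + h) C 1)            ≡⟨ cong suc (nC1≡n (2 + h)) ⟩
  3 + h                        ≡⟨ nC1≡n (3 + h) ⟨
  (3 + h) C 1                  ∎
  where open ≡-Reasoning
ballot-C (suc h) (suc v) = begin
  ballot (2 + h) (suc v) + ballot h (2 + v) + (S + suc h) C suc v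
    ≡⟨ cong (λ k → ballot (2 + h) (suc v) + ballot h (2 + v) + k C suc v) (+-suc S h) ⟩
  ballot (2 + h) (suc v) + ballot h (2 + v) + suc (S + h) C suc v
    ≡⟨ cong (ballot (2 + h) (suc v) + ballot h (2 + v) +_) (nCk+nC[k+1]≡[n+1]C[k+1] (S + h) v) ⟨
  ballot (2 + h) (suc v) + ballot h (2 + v) + ((S + h) C v + (S + h) C suc v)
    ≡⟨ interchange (ballot (2 + h) (suc v)) _ _ _ ⟩
  ballot (2 + h) (suc v) + (S + h) C v + (ballot h (2 + v) + (S + h) C suc v)
    ≡⟨ cong₂ _+_ (subst (λ k → ballot (2 + h) (suc v) + k C v ≡ k C suc v) (M v h) (ballot-C (2 + h) v))
                 (ballot-C h (suc v)) ⟩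
  (S + h) C suc v + (S + h) C suc (suc v)
    ≡⟨ nCk+nC[k+1]≡[n+1]C[k+1] (S + h) (suc v) ⟩
  suc (S + h) C suc (suc v)
    ≡⟨ cong (_C suc (suc v)) (+-suc S h) ⟨
  (S + suc h) C suc (suc v) ∎
  where
  open ≡-Reasoning
  S = suc (suc v) + suc (suc v)
  interchange : ∀ a b c d → a + b + (c + d) ≡ a + c + (b + d)
  interchange = solve-∀
  M : ∀ v h → suc v + suc v + (2 + h) ≡ suc (suc v) + suc (suc v) + h
  M = solve-∀

-- Absorption, with k C(n, k) moved to the left so that no subtraction occurs.
C-absorb : ∀ n k → suc k * (n C suc k) + k * (n C k) ≡ n * (n C k)
C-absorb zero    zero    = refl
C-absorb zero    (suc k) = cong₂ _+_ (*-comm (suc (suc k)) 0) (*-comm (suc k) 0)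
C-absorb (suc n) zero    = begin
  1 * (suc n C 1) + 0  ≡⟨ cong (λ c → 1 * c + 0) (nC1≡n (suc n)) ⟩
  1 * suc n + 0      ≡⟨ swap n ⟩
  suc n * 1          ∎
  where
  open ≡-Reasoning
  swap : ∀ n → 1 * suc n + 0 ≡ suc n * 1
  swap = solve-∀
C-absorb (suc n) (suc k) = begin
  (2 + k) * (suc n C (2 + k)) + suc k * (suc n C suc k)
    ≡⟨ cong₂ (λ x y → (2 + k) * x + suc k * y) (nCk+nC[k+1]≡[n+1]C[k+1] n (suc k)) (nCk+nC[k+1]≡[n+1]C[k+1] n k) ⟨
  (2 + k) * (b + c) + suc k * (a + b)
    ≡⟨ expand k a b c ⟩
  ((2 + k) * c + suc k * b) + b + ((suc k * b + k * a) + a)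
    ≡⟨ cong₂ (λ x y → x + b + (y + a)) (C-absorb n (suc k)) (C-absorb n k) ⟩
  n * b + b + (n * a + a)
    ≡⟨ collect n a b ⟩
  suc n * (a + b)
    ≡⟨ cong (suc n *_) (nCk+nC[k+1]≡[n+1]C[k+1] n k) ⟩
  suc n * (suc n C suc k) ∎
  where
  open ≡-Reasoning
  a = n C k
  b = n C suc k
  c = n C suc (suc k)
  expand : ∀ k a b c → (2 + k) * (b + c) + suc k * (a + b) ≡ ((2 + k) * c + suc k * b) + b + ((suc k * b + k * a) + a)
  expand = solve-∀
  collect : ∀ n a b → n * b + b + (n * a + a) ≡ suc n * (a + b)
  collect = solve-∀

ballot≡catalan : ∀ n → ballot 0 n ≡ catalan n
ballot≡catalan zero    = refl
ballot≡catalan (suc m) = sym (trans (cong (_/ suc n) central) (m*n/n≡m B (suc n)))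
  where
  open ≡-Reasoning
  n = suc m
  B = ballot 0 n
  c = (2 * n) C m

  2n : ∀ m → suc m + suc m + 0 ≡ 2 * suc m
  2n = solve-∀
  split : ∀ m B c → suc m * B + (2 * m + 1) * c ≡ suc m * (B + c) + m * c
  split = solve-∀
  join : ∀ m c → 2 * suc m * c ≡ c + (2 * m + 1) * c
  join = solve-∀
  total : ∀ m B → B + suc m * B ≡ B * suc (suc m)
  total = solve-∀

  reflected : B + c ≡ (2 * n) C n
  reflected = subst (λ k → B + k C m ≡ k C n) (2n m) (ballot-C 0 m)

  m+1*B : n * B ≡ c
  -- By absorption, `n` times `reflected` plus `m * c` is `2 * n * c`. Adding `(2 * m + 1) * c` on
  -- both sides avoids subtraction, since `n + m` is `2 * m + 1`.
  m+1*B = +-cancelʳ-≡ ((2 * m + 1) * c) (n * B) c (begin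
    n * B + (2 * m + 1) * c      ≡⟨ split m B c ⟩
    n * (B + c) + m * c          ≡⟨ cong (λ x → n * x + m * c) reflected ⟩
    n * ((2 * n) C n) + m * c      ≡⟨ C-absorb (2 * n) m ⟩
    2 * n * c                    ≡⟨ join m c ⟩
    c + (2 * m + 1) * c          ∎)

  central : (2 * n) C n ≡ B * suc n
  central = begin
    (2 * n) C n  ≡⟨ reflected ⟨
    B + c        ≡⟨ cong (B +_) m+1*B ⟨
    B + n * B    ≡⟨ total m B ⟩
    B * suc n    ∎

Dyck↔Fin : ∀ n → DyckPaths n ↔ Fin (catalan n)
Dyck↔Fin n = subst (λ k → DyckPaths n ↔ Fin k) (ballot≡catalan n) (Paths↔Fin 0 n)

-- Canonical permutations and Dyck words

-- The pair (m , d) stands for the run m ∷ reverse d: the entries above the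
-- minimum are stored in the order in which the stack releases them.
Runs : Set
Runs = List (ℕ × List ℕ)

starts : Runs → List ℕ
starts = map proj₁

others : Runs → List ℕ
others = concatMap proj₂

flatten : Runs → List ℕ
flatten []             = []
flatten ((m , d) ∷ rs) = m ∷ reverse d ++ flatten rs

toLists : Runs → List (List ℕ)
toLists = map λ (m , d) → m ∷ reverse d

data Canonical (p : ℕ) : Runs → Set where
  []  : Canonical p []
  run : ∀ {m d rs} → m < p → All (m <_) d → AllPairs _>_ d → Canonical m rs →
        Canonical p ((m , d) ∷ rs)

countdown : ℕ → List ℕ
countdown zero    = []
countdown (suc n) = suc n ∷ countdown n

-- Letterwise reading of a Dyck word.  The i-th U introduces the value
-- n + 1 - i; a U followed by D opens a run, the other values queue up in q and
-- each D not preceded by U moves the front of q into the current run.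
-- After U m: the last value introduced is m + 1, and rs are the runs to come.
-- After D m d: the current run starts with m + 1 and still has to receive d.
mutual
  data AfterU : ℕ → List ℕ → Runs → List Step → Set where
    rise : ∀ {m q rs w} → AfterU m (q ∷ʳ suc (suc m)) rs w →
           AfterU (suc m) q rs (U ∷ w)
    open-run : ∀ {m q d rs w} → AfterD m q d rs w →
           AfterU m q ((suc m , d) ∷ rs) (D ∷ w)

  data AfterD : ℕ → List ℕ → List ℕ → Runs → List Step → Set where
    take : ∀ {m x q d rs w} → AfterD m q d rs w → AfterD m (x ∷ q) (x ∷ d) rs (D ∷ w)
    next : ∀ {m q rs w} → AfterU m q rs w → AfterD (suc m) q [] rs (U ∷ w)
    stop : AfterD 0 [] [] [] []

mutual
  -- The next letter, or the end of the word, selects the rule, so a word yields at most one list of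
  -- runs. Injectivity rests on this.
  AfterU-deterministic : ∀ {m q rs rs′ w} → AfterU m q rs w → AfterU m q rs′ w → rs ≡ rs′
  AfterU-deterministic (rise r) (rise r′) = AfterU-deterministic r r′
  AfterU-deterministic (open-run r) (open-run r′) with AfterD-deterministic r r′
  ... | refl , refl = refl

  AfterD-deterministic : ∀ {m q d d′ rs rs′ w} → AfterD m q d rs w → AfterD m q d′ rs′ w →
                         d ≡ d′ × rs ≡ rs′
  AfterD-deterministic (take r) (take r′) with AfterD-deterministic r r′
  ... | refl , refl = refl , refl
  AfterD-deterministic (next r) (next r′) = refl , AfterU-deterministic r r′
  AfterD-deterministic stop stop = refl , refl

length-∷ʳ : ∀ {A : Set} (xs : List A) {x} → length (xs ∷ʳ x) ≡ suc (length xs)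
length-∷ʳ xs = trans (length-++ xs) (+-comm (length xs) 1)

mutual
  -- The height of the path is the queue length, plus one right after a `U`, whose value is not yet
  -- placed or queued.
  AfterU-dyck : ∀ {m q rs w} → AfterU m q rs w →
                T (dyckFromᵇ (suc (length q)) w) × countU w ≡ m
  AfterU-dyck {q = q} (rise {w = w} r) with AfterU-dyck r
  ... | p , refl = subst (λ h → T (dyckFromᵇ (suc h) w)) (length-∷ʳ q) p , refl
  AfterU-dyck (open-run r) = AfterD-dyck r

  AfterD-dyck : ∀ {m q d rs w} → AfterD m q d rs w →
                T (dyckFromᵇ (length q) w) × countU w ≡ m
  AfterD-dyck (take r) = AfterD-dyck r
  -- The cases on `q` bring the height into constructor form, on which `dyckFromᵇ` reduces.
  AfterD-dyck {q = []}    (next r) with AfterU-dyck r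
  ... | p , refl = p , refl
  AfterD-dyck {q = _ ∷ _} (next r) with AfterU-dyck r
  ... | p , refl = p , refl
  AfterD-dyck stop = _ , refl

mutual
  -- Besides running out of values, which the count of `U`s prevents, a reading can fail only at a
  -- `D` that finds the queue empty. There the path would go below 0.
  dyck-AfterU : ∀ m q w → T (dyckFromᵇ (suc (length q)) w) → countU w ≡ m →
                ∃[ rs ] AfterU m q rs w
  dyck-AfterU (suc m) q (U ∷ w) p refl
    with rs , r ← dyck-AfterU m (q ∷ʳ suc (suc m)) w
           (subst (λ h → T (dyckFromᵇ h w)) (cong suc (sym (length-∷ʳ q))) p) refl
    = rs , rise r
  dyck-AfterU m q (D ∷ w) p eq with d , rs , r ← dyck-AfterD m q w p eq = (suc m , d) ∷ rs , open-run r

  dyck-AfterD : ∀ m q w → T (dyckFromᵇ (length q) w) → countU w ≡ m →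
                ∃[ d ] ∃[ rs ] AfterD m q d rs w
  dyck-AfterD zero [] [] p eq = [] , [] , stop
  dyck-AfterD zero [] (U ∷ w) p ()
  dyck-AfterD m    [] (D ∷ w) ()
  dyck-AfterD (suc m) [] (U ∷ w) p refl with rs , r ← dyck-AfterU m [] w p refl = [] , rs , next r
  dyck-AfterD (suc m) q@(_ ∷ _) (U ∷ w) p refl with rs , r ← dyck-AfterU m q w p refl = [] , rs , next r
  dyck-AfterD m (x ∷ q) (D ∷ w) p eq with d , rs , r ← dyck-AfterD m q w p eq = x ∷ d , rs , take r

replicate-∷ : ∀ {A : Set} j (x : A) w → replicate (suc j) x ++ w ≡ replicate j x ++ x ∷ w
replicate-∷ zero    x w = refl
replicate-∷ (suc j) x w = cong (x ∷_) (replicate-∷ j x w)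

ΦRuns-∷ : ∀ {p m a rs w} → m ≤ p → ΦRuns m rs ≡ just w →
          ΦRuns p ((m ∷ a) ∷ rs) ≡ just (replicate (p ∸ m) U ++ replicate (suc (length a)) D ++ w)
ΦRuns-∷ m≤p eq rewrite Equivalence.to T-≡ (<⇒<ᵇ (s≤s m≤p)) | eq = refl

mutual
  -- `Φ` writes each block of `U`s at once, a reading letter by letter. Here `j` counts the letters
  -- of the current block already read, so `j + suc m` is the previous run minimum, or `n + 1` in
  -- the first block.
  AfterU-Φ : ∀ {m q rs w} → AfterU m q rs w →
             ∀ j → ΦRuns (j + suc m) (toLists rs) ≡ just (replicate j U ++ w)
  AfterU-Φ {suc m} {rs = rs} (rise {w = w} r) j = begin
    ΦRuns (j + suc (suc m)) (toLists rs)  ≡⟨ cong (λ p → ΦRuns p (toLists rs)) (+-suc j (suc m)) ⟩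
    ΦRuns (suc j + suc m) (toLists rs)    ≡⟨ AfterU-Φ r (suc j) ⟩
    just (replicate (suc j) U ++ w)       ≡⟨ cong just (replicate-∷ j U w) ⟩
    just (replicate j U ++ U ∷ w)         ∎
    where open ≡-Reasoning
  AfterU-Φ {m} (open-run {d = d} r) j with w′ , eq , refl ← AfterD-Φ r
    = trans (ΦRuns-∷ (m≤n+m (suc m) j) eq)
        (cong₂ (λ k l → just (replicate k U ++ D ∷ replicate l D ++ w′)) (m+n∸n≡m j (suc m)) (length-reverse d))

  AfterD-Φ : ∀ {m q d rs w} → AfterD m q d rs w →
             ∃[ w′ ] ΦRuns (suc m) (toLists rs) ≡ just w′ × w ≡ replicate (length d) D ++ w′
  AfterD-Φ (take r) with w′ , eq , refl ← AfterD-Φ r = w′ , eq , refl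
  AfterD-Φ (next r) = _ , AfterU-Φ r 1 , refl
  AfterD-Φ stop     = [] , refl , refl

flatten-∷-↭ : ∀ m d rs → flatten ((m , d) ∷ rs) ↭ m ∷ d ++ flatten rs
flatten-∷-↭ m d rs = prep m (↭-++⁺ʳ (flatten rs) (↭-reverse d))

flatten-↭ : ∀ rs → flatten rs ↭ starts rs ++ others rs
flatten-↭ []             = ↭-refl
flatten-↭ ((m , d) ∷ rs) = ↭-trans (flatten-∷-↭ m d rs)
  (prep m (↭-trans (↭-++⁺ˡ d (flatten-↭ rs)) (shifts d (starts rs))))

mutual
  AfterU-↭ : ∀ {m q rs w} → AfterU m q rs w → flatten rs ↭ q ++ countdown (suc m)
  AfterU-↭ {q = q} {rs} (rise r) = subst (flatten rs ↭_) (++-assoc q _ _) (AfterU-↭ r)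
  AfterU-↭ {q = q} (open-run {d = d} {rs} r) =
    ↭-trans (flatten-∷-↭ _ d rs) (↭-trans (prep _ (AfterD-↭ r)) (↭-sym (shift _ q _)))

  AfterD-↭ : ∀ {m q d rs w} → AfterD m q d rs w → d ++ flatten rs ↭ q ++ countdown m
  AfterD-↭ (take r) = prep _ (AfterD-↭ r)
  AfterD-↭ (next r) = AfterU-↭ r
  AfterD-↭ stop     = ↭-refl

AllPairs-resp-⊆ : ∀ {R : ℕ → ℕ → Set} {xs ys} → xs ⊆ ys → AllPairs R ys → AllPairs R xs
AllPairs-resp-⊆ []         []       = []
AllPairs-resp-⊆ (skip _ τ) (_ ∷ ps) = AllPairs-resp-⊆ τ ps
AllPairs-resp-⊆ (refl ∷ τ) (p ∷ ps) = All-resp-⊆ τ p ∷ AllPairs-resp-⊆ τ ps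

drop-middle : ∀ (q : List ℕ) {x xs} → q ++ xs ⊆ q ++ x ∷ xs
drop-middle q = ++⁺ (⊆-refl {x = q}) (skip _ ⊆-refl)

mutual
  -- A queue preserves order: the non-minima leave it as they were introduced, from large to small.
  -- This gives the decrease of `others`.
  AfterU-others : ∀ {m q rs w} → AfterU m q rs w → others rs ⊆ q ++ countdown (suc m)
  AfterU-others {q = q} {rs} (rise r) = subst (others rs ⊆_) (++-assoc q _ _) (AfterU-others r)
  AfterU-others {q = q} (open-run r) = ⊆-trans (AfterD-others r) (drop-middle q)

  AfterD-others : ∀ {m q d rs w} → AfterD m q d rs w → d ++ others rs ⊆ q ++ countdown m
  AfterD-others (take r) = refl ∷ AfterD-others r
  AfterD-others (next r) = AfterU-others r
  AfterD-others stop     = []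

mutual
  AfterU-canonical : ∀ {m q rs w} → AfterU m q rs w → AllPairs _>_ (q ++ countdown (suc m)) →
                     Canonical (2 + m) rs
  AfterU-canonical {q = q} (rise r) ps = weaken (AfterU-canonical r (subst (AllPairs _>_) (sym (++-assoc q _ _)) ps))
    where
    weaken : ∀ {p rs} → Canonical p rs → Canonical (suc p) rs
    weaken []                  = []
    weaken (run m<p m<d ps rs) = run (m<n⇒m<1+n m<p) m<d ps rs
  AfterU-canonical {m} {q} (open-run r) ps with m<d , ps′ , c ← AfterD-canonical r ps
    = run ≤-refl m<d ps′ c

  -- The hypothesis keeps `suc m`, the minimum already placed, behind the queue. It thereby bounds
  -- from below everything the current run can still receive.
  AfterD-canonical : ∀ {m q d rs w} → AfterD m q d rs w → AllPairs _>_ (q ++ countdown (suc m)) →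
                     All (suc m <_) d × AllPairs _>_ d × Canonical (suc m) rs
  AfterD-canonical {q = x ∷ q} (take {d = d} {rs} r) (px ∷ ps) with m<d , ps′ , c ← AfterD-canonical r ps
    = All.lookup px (∈-++⁺ʳ q (here refl)) ∷ m<d
    , Allₚ.++⁻ˡ d (All-resp-⊆ (⊆-trans (AfterD-others r) (drop-middle q)) px) ∷ ps′ , c
  AfterD-canonical {q = q} (next r) ps = [] , [] , AfterU-canonical r (AllPairs-resp-⊆ (drop-middle q) ps)
  AfterD-canonical stop ps = [] , [] , []

starts-< : ∀ {p rs} → Canonical p rs → All (_< p) (starts rs)
starts-< []                 = []
starts-< (run m<p _ _ c) = m<p ∷ All.map (λ s<m → <-trans s<m m<p) (starts-< c)

before-> : ∀ q {x xs} → AllPairs _>_ (q ++ x ∷ xs) → All (x <_) q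
before-> []      _        = []
before-> (_ ∷ q) (p ∷ ps) = All.lookup p (∈-++⁺ʳ q (here refl)) ∷ before-> q ps

countdown-≤ : ∀ {n x} → x ∈ countdown n → x ≤ n
countdown-≤ {suc n} (here refl) = ≤-refl
countdown-≤ {suc n} (there x∈)  = m≤n⇒m≤1+n (countdown-≤ x∈)

0∉ : ∀ {m q} n → All (m <_) q → 0 ∉ q ++ countdown n
0∉ {q = q} n m<q 0∈ with ∈-++⁻ q 0∈
... | inj₁ 0∈q = contradiction (All.lookup m<q 0∈q) λ ()
... | inj₂ 0∈c = 0∉countdown n 0∈c
  where
  0∉countdown : ∀ n → 0 ∉ countdown n
  0∉countdown (suc n) (there 0∈) = 0∉countdown n 0∈

mutual
  -- The letter is forced. If the next run minimum is the value `suc m` just introduced, it is `D`;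
  -- if it is smaller, `suc m` is not a minimum and must join the queue, so it is `U`.
  canonical-AfterU : ∀ m q rs → Canonical (2 + m) rs → AllPairs _>_ (others rs) →
                     flatten rs ↭ q ++ countdown (suc m) → AllPairs _>_ (q ++ countdown (suc m)) →
                     ∃[ w ] AfterU m q rs w
  canonical-AfterU m q [] _ _ π↭ _ =
    contradiction (∈-resp-↭ (↭-sym π↭) (∈-++⁺ʳ q (here refl))) λ ()
  canonical-AfterU m q ((s , d) ∷ rs) (run s<2+m s<d d> c) os π↭ qs with m≤n⇒m<n∨m≡n (≤-pred s<2+m)
  ... | inj₂ refl
    with w , r ← canonical-AfterD m q d rs s<d os c
           (drop-mid [] q (↭-trans (↭-sym (flatten-∷-↭ s d rs)) π↭)) qs
    = D ∷ w , open-run r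
  canonical-AfterU (suc m) q rs@(_ ∷ _) (run _ s<d d> c) os π↭ qs | inj₁ s<1+m
    with w , r ← canonical-AfterU m (q ∷ʳ suc (suc m)) rs (run s<1+m s<d d> c) os
           (subst (flatten rs ↭_) (sym (++-assoc q _ _)) π↭)
           (subst (AllPairs _>_) (sym (++-assoc q _ _)) qs)
    = U ∷ w , rise r
  canonical-AfterU zero q ((zero , _) ∷ _) _ _ π↭ qs | inj₁ _ =
    contradiction (∈-resp-↭ π↭ (here refl)) (0∉ 1 (before-> q qs))
  canonical-AfterU zero q ((suc _ , _) ∷ _) _ _ _ _ | inj₁ (s≤s ())

  canonical-AfterD : ∀ m q d rs → All (suc m <_) d → AllPairs _>_ (d ++ others rs) →
                     Canonical (suc m) rs → d ++ flatten rs ↭ q ++ countdown m →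
                     AllPairs _>_ (q ++ countdown (suc m)) → ∃[ w ] AfterD m q d rs w
  canonical-AfterD zero    []      [] [] _ _ _ _ _ = [] , stop
  canonical-AfterD (suc m) []      [] [] _ _ _ π↭ _ = contradiction (↭-sym π↭) ¬x∷xs↭[]
  canonical-AfterD m       (_ ∷ _) [] [] _ _ _ π↭ _ = contradiction (↭-sym π↭) ¬x∷xs↭[]
  canonical-AfterD (suc m) q [] rs@(_ ∷ _) _ os c π↭ qs
    with w , r ← canonical-AfterU m q rs c os π↭ (AllPairs-resp-⊆ (drop-middle q) qs)
    = U ∷ w , next r
  canonical-AfterD zero q [] ((zero , _) ∷ _) _ _ _ π↭ qs =
    contradiction (∈-resp-↭ π↭ (here refl)) (0∉ 0 (before-> q qs))
  canonical-AfterD zero q [] ((suc _ , _) ∷ _) _ _ (run (s≤s ()) _ _ _) _ _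
  -- With an empty queue every remaining value is at most `m`, but `x` exceeds the current minimum
  -- `suc m`.
  canonical-AfterD m [] (x ∷ d) rs (m<x ∷ _) _ _ π↭ _ =
    contradiction (countdown-≤ (∈-resp-↭ π↭ (here refl))) (<⇒≱ (<-trans (n<1+n m) m<x))
  -- Front of the queue and next entry coincide, both being the largest value left: `y` heads a
  -- decreasing list, `x` heads the decreasing non-minima, and the later minima lie below `suc m`,
  -- hence below `y`.
  canonical-AfterD m (y ∷ q) (x ∷ d) rs (m<x ∷ m<d) (x> ∷ os) c π↭ (y> ∷ qs) with x≡y
    where
    y≤x : y ∈ x ∷ d ++ flatten rs → y ≤ x
    y≤x (here y≡x) = ≤-reflexive y≡x
    y≤x (there y∈) with ∈-++⁻ d y∈
    ... | inj₁ y∈d = <⇒≤ (All.lookup x> (∈-++⁺ˡ y∈d))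
    ... | inj₂ y∈rs with ∈-++⁻ (starts rs) (∈-resp-↭ (flatten-↭ rs) y∈rs)
    ...   | inj₁ y∈s = contradiction (All.lookup (starts-< c) y∈s)
                         (<-asym (All.lookup y> (∈-++⁺ʳ q (here refl))))
    ...   | inj₂ y∈o = <⇒≤ (All.lookup x> (∈-++⁺ʳ d y∈o))

    x≤y : x ∈ y ∷ q ++ countdown m → x ≤ y
    x≤y (here x≡y) = ≤-reflexive x≡y
    x≤y (there x∈) = <⇒≤ (All.lookup (All-resp-⊆ (drop-middle q) y>) x∈)

    x≡y : x ≡ y
    x≡y = ≤-antisym (x≤y (∈-resp-↭ π↭ (here refl))) (y≤x (∈-resp-↭ (↭-sym π↭) (here refl)))
  ... | refl with w , r ← canonical-AfterD m q d rs m<d os c (drop-∷ π↭) qs = D ∷ w , take r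

-- The stack

-- The machine without fuel or accumulator: on exhausted input the stack itself is the remaining
-- output. A push shortens the input; a pop keeps it and shortens the stack.
scRun : List ℕ → List ℕ → List ℕ
scRun []      s       = s
scRun (a ∷ i) []      = scRun i (a ∷ [])
scRun (a ∷ i) (t ∷ s) =
  if contains132-consᵇ (a ∷ t ∷ s) then t ∷ scRun (a ∷ i) s else scRun i (a ∷ t ∷ s)

reverse-++-∷ : ∀ {A : Set} (x : A) xs ys → reverse (x ∷ xs) ++ ys ≡ reverse xs ++ x ∷ ys
reverse-++-∷ x xs ys = trans (cong (_++ ys) (unfold-reverse x xs)) (++-assoc (reverse xs) _ _)

move-suc : ∀ x y → x + x + suc y ≡ x + suc x + y
move-suc x y = trans (+-suc (x + x) y) (cong (_+ y) (sym (+-suc x x)))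

-- The fuel: every input entry still costs a push and a pop, every stack entry a pop.
scLoop≡scRun : ∀ k i s o → length i + length i + length s ≤ k →
               scLoop k i s o ≡ reverse o ++ scRun i s
scLoop≡scRun zero    []      []      o _ = sym (++-identityʳ _)
scLoop≡scRun (suc k) []      []      o _ = sym (++-identityʳ _)
scLoop≡scRun (suc k) []      (t ∷ s) o (s≤s l) =
  trans (scLoop≡scRun k [] s (t ∷ o) l) (reverse-++-∷ t o s)
scLoop≡scRun (suc k) (a ∷ i) []      o (s≤s l) =
  scLoop≡scRun k i (a ∷ []) o (≤-trans (≤-reflexive (move-suc (length i) 0)) l)
scLoop≡scRun (suc k) (a ∷ i) (t ∷ s) o (s≤s l) with contains132-consᵇ (a ∷ t ∷ s)
... | true  = trans (scLoop≡scRun k (a ∷ i) s (t ∷ o) (≤-trans (≤-reflexive (sym (+-suc (length i + suc (length i)) (length s)))) l))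
                    (reverse-++-∷ t o _)
... | false = scLoop≡scRun k i (a ∷ t ∷ s) o (≤-trans (≤-reflexive (move-suc (length i) (suc (length s)))) l)

SC132≡scRun : ∀ π → SC132 π ≡ scRun π []
SC132≡scRun π = scLoop≡scRun (2 * length π) π [] []
  (≤-reflexive (trans (+-identityʳ _) (cong (length π +_) (sym (+-identityʳ _)))))

-- Later entries only land above or between the entries already on the stack and never reorder them.
-- A 231 on the stack is thus a 231 of the output.
stack-⊆-scRun : ∀ i s → s ⊆ scRun i s
stack-⊆-scRun []      s       = ⊆-refl
stack-⊆-scRun (a ∷ i) []      = minimum _
stack-⊆-scRun (a ∷ i) (t ∷ s) = if-elim (contains132-consᵇ (a ∷ t ∷ s))
  (refl ∷ stack-⊆-scRun (a ∷ i) s)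
  (⊆-trans (skip a ⊆-refl) (stack-⊆-scRun i (a ∷ t ∷ s)))
  where
  if-elim : ∀ {xs ys zs : List ℕ} b → xs ⊆ ys → xs ⊆ zs → xs ⊆ (if b then ys else zs)
  if-elim true  p q = p
  if-elim false p q = q

Avoids132 : List ℕ → Set
Avoids132 s = contains132-consᵇ s ≡ false

<ᵇ-false : ∀ {x y} → y ≤ x → (x <ᵇ y) ≡ false
<ᵇ-false {x} {y} y≤x with x <ᵇ y in eq
... | false = refl
... | true  = contradiction (<ᵇ⇒< x y (Equivalence.from T-≡ eq)) (≤⇒≯ y≤x)

<ᵇ-true : ∀ {x y} → x < y → (x <ᵇ y) ≡ true
<ᵇ-true x<y = Equivalence.to T-≡ (<⇒<ᵇ x<y)

avoids132-tail : ∀ t s → Avoids132 (t ∷ s) → Avoids132 s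
avoids132-tail t []          _  = refl
avoids132-tail t (_ ∷ [])    _  = refl
avoids132-tail t (u ∷ v ∷ s) av with (t <ᵇ v) ∧ (v <ᵇ u) | av
... | false | av′ = av′

-- A new 132 must be `a`, `t`, `u` at the top with `a < u < t`. This lemma and the next two exclude
-- it by `t < a`, by `t < u` and by `u ≤ a`.
avoids132-∷-> : ∀ {a t} s → t < a → Avoids132 (t ∷ s) → Avoids132 (a ∷ t ∷ s)
avoids132-∷-> []      _   _  = refl
avoids132-∷-> {a} {t} (u ∷ s) t<a av with <-≤-connex a u
... | inj₁ a<u rewrite <ᵇ-false (<⇒≤ (<-trans t<a a<u)) | ∧-zeroʳ (a <ᵇ u) = av
... | inj₂ u≤a rewrite <ᵇ-false u≤a = av

avoids132-∷-<₂ : ∀ {a t} s → All (t <_) s → Avoids132 (t ∷ s) → Avoids132 (a ∷ t ∷ s)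
avoids132-∷-<₂ []      _         _  = refl
avoids132-∷-<₂ {a} (u ∷ s) (t<u ∷ _) av rewrite <ᵇ-false (<⇒≤ t<u) | ∧-zeroʳ (a <ᵇ u) = av

avoids132-∷-≤₃ : ∀ {a t u} s → u ≤ a → Avoids132 (t ∷ u ∷ s) → Avoids132 (a ∷ t ∷ u ∷ s)
avoids132-∷-≤₃ s u≤a av rewrite <ᵇ-false u≤a = av

scRun-push : ∀ {a} i {t} s → Avoids132 (a ∷ t ∷ s) → scRun (a ∷ i) (t ∷ s) ≡ scRun i (a ∷ t ∷ s)
scRun-push i s av rewrite av = refl

scRun-pop : ∀ {a} i {t u} s → a < u → u < t →
            scRun (a ∷ i) (t ∷ u ∷ s) ≡ t ∷ scRun (a ∷ i) (u ∷ s)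
scRun-pop i s a<u u<t rewrite <ᵇ-true a<u | <ᵇ-true u<t = refl

-- As long as some `t` of `d` is on top, its lower neighbour `u`, in `d` or equal to `m`, satisfies
-- `a < u < t`, so `a` would create a 132 and `t` is popped.
scRun-clear : ∀ {a} i {m} s d → AllPairs _>_ d → All (m <_) d → a < m →
              scRun (a ∷ i) (d ++ m ∷ s) ≡ d ++ scRun (a ∷ i) (m ∷ s)
scRun-clear i s []          _                _           _   = refl
scRun-clear i s (t ∷ [])    _                (m<t ∷ _)   a<m = scRun-pop i s a<m m<t
scRun-clear i s (t ∷ u ∷ d) ((u<t ∷ _) ∷ ps) (_ ∷ m<d@(m<u ∷ _)) a<m =
  trans (scRun-pop i (d ++ _ ∷ s) (<-trans a<m m<u) u<t) (cong (t ∷_) (scRun-clear i s (u ∷ d) ps m<d a<m))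

avoids132-push : ∀ {x m} ms d → m < x → All (_< x) d → Avoids132 (d ++ m ∷ ms) → Avoids132 (x ∷ d ++ m ∷ ms)
avoids132-push ms []      m<x _         av = avoids132-∷-> ms m<x av
avoids132-push ms (y ∷ d) _   (y<x ∷ _) av = avoids132-∷-> (d ++ _ ∷ ms) y<x av

scRun-push-run : ∀ {x} i {m} ms d → m < x → All (_< x) d → Avoids132 (d ++ m ∷ ms) →
                 scRun (x ∷ i) (d ++ m ∷ ms) ≡ scRun i (x ∷ d ++ m ∷ ms)
scRun-push-run i ms []      m<x x> av = scRun-push i ms (avoids132-push ms [] m<x x> av)
scRun-push-run i ms (y ∷ d) m<x x> av = scRun-push i (d ++ _ ∷ ms) (avoids132-push ms (y ∷ d) m<x x> av)

scRun-run : ∀ i {m} ms d → AllPairs _>_ d → All (m <_) d → Avoids132 (m ∷ ms) →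
            scRun (reverse d ++ i) (m ∷ ms) ≡ scRun i (d ++ m ∷ ms) × Avoids132 (d ++ m ∷ ms)
scRun-run i ms []      _         _           av = refl , av
scRun-run i {m} ms (x ∷ d) (x> ∷ ps) (m<x ∷ m<d) av
  with eq , av′ ← scRun-run (x ∷ i) ms d ps m<d av
  = trans (cong (λ j → scRun j (m ∷ ms)) (reverse-++-∷ x d i))
      (trans eq (scRun-push-run i ms d m<x x> av′))
  , avoids132-push ms d m<x x> av′

-- A new minimum a < m clears the entries of the current run above m and is
-- then pushed on m, so the stack keeps exactly the run minima.
scRun-canonical-after : ∀ {m} ms d rs → Canonical m rs → AllPairs _>_ d → All (m <_) d →
                        All (m <_) ms → Avoids132 (m ∷ ms) →
                        scRun (flatten rs) (d ++ m ∷ ms) ≡ d ++ others rs ++ reverse (starts rs) ++ m ∷ ms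
scRun-canonical-after ms d []             _                     _  _   _    _  = refl
scRun-canonical-after {m} ms d ((a , e) ∷ rs) (run a<m a<e e> c) d> m<d m<ms av = begin
  scRun (a ∷ reverse e ++ flatten rs) (d ++ m ∷ ms)
    ≡⟨ scRun-clear (reverse e ++ flatten rs) ms d d> m<d a<m ⟩
  d ++ scRun (a ∷ reverse e ++ flatten rs) (m ∷ ms)
    ≡⟨ cong (d ++_) (scRun-push (reverse e ++ flatten rs) ms av′) ⟩
  d ++ scRun (reverse e ++ flatten rs) (a ∷ m ∷ ms)
    ≡⟨ cong (d ++_) (proj₁ (scRun-run (flatten rs) (m ∷ ms) e e> a<e av′)) ⟩
  d ++ scRun (flatten rs) (e ++ a ∷ m ∷ ms)
    ≡⟨ cong (d ++_) (scRun-canonical-after (m ∷ ms) e rs c e> a<e (a<m ∷ All.map (<-trans a<m) m<ms) av′) ⟩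
  d ++ e ++ others rs ++ reverse (starts rs) ++ a ∷ m ∷ ms
    ≡⟨ cong (d ++_) (sym (++-assoc e (others rs) _)) ⟩
  d ++ (e ++ others rs) ++ reverse (starts rs) ++ a ∷ m ∷ ms
    ≡⟨ cong (λ s → d ++ (e ++ others rs) ++ s) (sym (reverse-++-∷ a (starts rs) (m ∷ ms))) ⟩
  d ++ (e ++ others rs) ++ reverse (a ∷ starts rs) ++ m ∷ ms ∎
  where
  open ≡-Reasoning
  av′ = avoids132-∷-<₂ {a} ms m<ms av

SC132-flatten : ∀ {p rs} → Canonical p rs → SC132 (flatten rs) ≡ others rs ++ reverse (starts rs)
SC132-flatten [] = refl
SC132-flatten {rs = (m , d) ∷ rs} (run _ m<d d> c) = begin
  SC132 (m ∷ reverse d ++ flatten rs)            ≡⟨ SC132≡scRun (m ∷ reverse d ++ flatten rs) ⟩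
  scRun (reverse d ++ flatten rs) (m ∷ [])       ≡⟨ proj₁ (scRun-run (flatten rs) [] d d> m<d refl) ⟩
  scRun (flatten rs) (d ++ m ∷ [])               ≡⟨ scRun-canonical-after [] d rs c d> m<d [] refl ⟩
  d ++ others rs ++ reverse (starts rs) ++ m ∷ []  ≡⟨ ++-assoc d (others rs) _ ⟨
  (d ++ others rs) ++ reverse (starts rs) ++ m ∷ []  ≡⟨ cong ((d ++ others rs) ++_) (unfold-reverse m (starts rs)) ⟨
  (d ++ others rs) ++ reverse (m ∷ starts rs)    ∎
  where open ≡-Reasoning

-- The pattern 231 in the output and the parsing of sortable inputs

data Contains231 (xs : List ℕ) : Set where
  231-at : ∀ {x y z} → z < x → x < y → x ∷ y ∷ z ∷ [] ⊆ xs → Contains231 xs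

contains231-⊆ : ∀ {xs ys} → xs ⊆ ys → Contains231 xs → Contains231 ys
contains231-⊆ τ (231-at z<x x<y σ) = 231-at z<x x<y (⊆-trans σ τ)

-- A descent to a > m does not clear the stack: a stops on the first x > a
-- whose lower neighbour y is below a, and a x y is a 231.
scRun-contains231 : ∀ {a} i {m} ms d x → AllPairs _>_ (x ∷ d) → m < a → a < x → a ∉ d →
                    Avoids132 (x ∷ d ++ m ∷ ms) →
                    Contains231 (scRun (a ∷ i) (x ∷ d ++ m ∷ ms))
scRun-contains231 {a} i {m} ms [] x _ m<a a<x _ av =
  231-at m<a a<x (⊆-trans (refl ∷ refl ∷ refl ∷ minimum ms) (subst (_ ⊆_)
    (sym (scRun-push i (m ∷ ms) (avoids132-∷-≤₃ ms (<⇒≤ m<a) av)))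
    (stack-⊆-scRun i (a ∷ x ∷ m ∷ ms))))
scRun-contains231 {a} i {m} ms (y ∷ d) x ((y<x ∷ _) ∷ ps) m<a a<x a∉ av with <-cmp a y
... | tri≈ _ refl _ = contradiction (here refl) a∉
... | tri> _ _ y<a =
  231-at y<a a<x (⊆-trans (refl ∷ refl ∷ refl ∷ minimum (d ++ m ∷ ms)) (subst (_ ⊆_)
    (sym (scRun-push i (y ∷ d ++ m ∷ ms) (avoids132-∷-≤₃ (d ++ m ∷ ms) (<⇒≤ y<a) av)))
    (stack-⊆-scRun i (a ∷ x ∷ y ∷ d ++ m ∷ ms))))
... | tri< a<y _ _ = subst Contains231 (sym (scRun-pop i (d ++ m ∷ ms) a<y y<x))
  (contains231-⊆ (skip x ⊆-refl)
    (scRun-contains231 i ms d y ps m<a a<y (a∉ ∘ there) (avoids132-tail x (y ∷ d ++ m ∷ ms) av)))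

-- The input i is read in the middle of a run with minimum m, of which d has
-- already been read; top is the whole run above m.
record Parse (m : ℕ) (d i : List ℕ) : Set where
  constructor parse
  field
    top       : List ℕ
    rest      : Runs
    input-eq  : reverse d ++ i ≡ reverse top ++ flatten rest
    top->     : AllPairs _>_ top
    m<top     : All (m <_) top
    canonical : Canonical m rest

-- Induction on the input; the stack holds the current run `d` above its minimum `m` and the earlier
-- minima `ms`. A next entry below `m` clears `d` and opens a run. One above `m` must exceed the
-- top, or `scRun-contains231` applies. `Avoids132 (m ∷ ms)` describes the stack once `d` is
-- cleared.
scRun-parse : ∀ i {m} ms d → AllPairs _>_ d → All (m <_) d → All (m <_) ms → Avoids132 (m ∷ ms) →
              Avoids132 (d ++ m ∷ ms) → Unique i → All (_∉ m ∷ d) i →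
              ¬ Contains231 (scRun i (d ++ m ∷ ms)) → Parse m d i
scRun-parse [] ms d d> m<d _ _ _ _ _ _ = parse d [] refl d> m<d []
scRun-parse (a ∷ i) {m} ms d d> m<d m<ms avm av (a∉i ∷ un) (a∉ ∷ i∉) avoids with <-cmp a m
... | tri≈ _ refl _ = contradiction (here refl) a∉
... | tri< a<m _ _ = below
  where
  avoids-a = avoids132-∷-<₂ {a} ms m<ms avm

  below : Parse m d (a ∷ i)
  below
    with parse top rest eq top> a<top c ←
      scRun-parse i (m ∷ ms) [] [] [] (a<m ∷ All.map (<-trans a<m) m<ms) avoids-a avoids-a un
        (All.map (λ a≢x → λ { (here refl) → a≢x refl }) a∉i)
        (λ c → avoids (subst Contains231 (sym (scRun-clear i ms d d> m<d a<m))
          (contains231-⊆ (++⁺ˡ d ⊆-refl) (subst Contains231 (sym (scRun-push i ms avoids-a)) c))))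
    = parse d ((a , top) ∷ rest) (cong (λ j → reverse d ++ a ∷ j) eq) d> m<d (run a<m a<top top> c)
scRun-parse (a ∷ i) {m} ms d d> m<d m<ms avm av (a∉i ∷ un) (a∉ ∷ i∉) avoids | tri> _ _ m<a = above d d> m<d av a∉ i∉ avoids
  where
  pushed : ∀ d → AllPairs _>_ d → All (m <_) d → All (_< a) d → Avoids132 (d ++ m ∷ ms) → All (_∉ m ∷ d) i →
           ¬ Contains231 (scRun (a ∷ i) (d ++ m ∷ ms)) → Parse m d (a ∷ i)
  pushed d d> m<d d<a av i∉ avoids
    with parse top rest eq top> m<top c ←
      scRun-parse i ms (a ∷ d) (d<a ∷ d>) (m<a ∷ m<d) m<ms avm (avoids132-push ms d m<a d<a av) un
        (All.zipWith (λ (x∉ , a≢x) → λ { (here refl) → x∉ (here refl)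
                                       ; (there (here refl)) → a≢x refl
                                       ; (there (there x∈)) → x∉ (there x∈) }) (i∉ , a∉i))
        (avoids ∘ subst Contains231 (sym (scRun-push-run i ms d m<a d<a av)))
    = parse top rest (trans (sym (reverse-++-∷ a d i)) eq) top> m<top c

  above : ∀ d → AllPairs _>_ d → All (m <_) d → Avoids132 (d ++ m ∷ ms) → a ∉ m ∷ d → All (_∉ m ∷ d) i →
          ¬ Contains231 (scRun (a ∷ i) (d ++ m ∷ ms)) → Parse m d (a ∷ i)
  above []      d> m<d av a∉ i∉ avoids = pushed [] d> m<d [] av i∉ avoids
  above (x ∷ d) d>@(x> ∷ _) m<d av a∉ i∉ avoids with <-cmp a x
  ... | tri< a<x _ _ = contradiction (scRun-contains231 i ms d x d> m<a a<x (a∉ ∘ there ∘ there) av) avoids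
  ... | tri≈ _ refl _ = contradiction (there (here refl)) a∉
  ... | tri> _ _ x<a = pushed (x ∷ d) d> m<d (x<a ∷ All.map (λ y<x → <-trans y<x x<a) x>) av i∉ avoids

-- From Sort to Dyck paths

-- find31 is private to Defs; unification recovers it from its only use.
find31-recovered : Σ[ f ∈ (ℕ → List ℕ → Bool) ] ∀ x xs → contains231ᵇ (x ∷ xs) ≡ f x xs ∨ contains231ᵇ xs
find31-recovered = _ , λ x xs → refl

find31 : ℕ → List ℕ → Bool
find31 = proj₁ find31-recovered

T-∨⁻ : ∀ x {y} → T (x ∨ y) → T x ⊎ T y
T-∨⁻ x = Equivalence.to (T-∨ {x})

find31-complete : ∀ {x y z} xs → z < x → x < y → y ∷ z ∷ [] ⊆ xs → T (find31 x xs)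
find31-complete {x} (y ∷ xs) z<x x<y (skip _ τ) =
  Equivalence.from (T-∨ {(x <ᵇ y) ∧ any (_<ᵇ x) xs}) (inj₂ (find31-complete xs z<x x<y τ))
find31-complete {x} (y ∷ xs) z<x x<y (refl ∷ τ) =
  Equivalence.from (T-∨ {(x <ᵇ y) ∧ any (_<ᵇ x) xs})
    (inj₁ (T-∧⁺ (<⇒<ᵇ x<y) (any⁺ (_<ᵇ x) (lose (to∈ τ) (<⇒<ᵇ z<x)))))

contains231-complete : ∀ {xs} → Contains231 xs → T (contains231ᵇ xs)
contains231-complete {v ∷ xs} (231-at z<x x<y (skip _ τ)) =
  Equivalence.from (T-∨ {find31 v xs}) (inj₂ (contains231-complete (231-at z<x x<y τ)))
contains231-complete {x ∷ xs} (231-at z<x x<y (refl ∷ τ)) =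
  Equivalence.from (T-∨ {find31 x xs}) (inj₁ (find31-complete xs z<x x<y τ))

find31-valley : ∀ {x} ds {as} → All (_< x) ds → AllPairs _<_ as → ¬ T (find31 x (ds ++ as))
find31-valley {x} (y ∷ ds) {as} (y<x ∷ ds<x) as< p
  with T-∨⁻ ((x <ᵇ y) ∧ any (_<ᵇ x) (ds ++ as)) p
... | inj₁ q = contradiction (<ᵇ⇒< x y (proj₁ (T-∧⁻ q))) (<-asym y<x)
... | inj₂ q = find31-valley ds ds<x as< q
find31-valley {x} [] {y ∷ as} [] (y< ∷ as<) p with T-∨⁻ ((x <ᵇ y) ∧ any (_<ᵇ x) as) p
... | inj₂ q = find31-valley [] [] as< q
... | inj₁ q with x<y , any<x ← T-∧⁻ {x <ᵇ y} q with z , z∈ , z<x ← find (any⁻ (_<ᵇ x) as any<x)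
  = <-asym (<ᵇ⇒< z x z<x) (<-trans (<ᵇ⇒< x y x<y) (All.lookup y< z∈))

-- In a decreasing list followed by an increasing one, an entry larger than an earlier one lies in
-- the increasing part, so everything after it is larger still and cannot end a 231.
contains231-valley : ∀ ds {as} → AllPairs _>_ ds → AllPairs _<_ as → ¬ T (contains231ᵇ (ds ++ as))
contains231-valley (x ∷ ds) {as} (x> ∷ ds>) as< p with T-∨⁻ (find31 x (ds ++ as)) p
... | inj₁ q = find31-valley ds x> as< q
... | inj₂ q = contains231-valley ds ds> as< q
contains231-valley [] {x ∷ as} [] (_ ∷ as<) p with T-∨⁻ (find31 x as) p
... | inj₁ q = find31-valley {x} [] [] as< q
... | inj₂ q = contains231-valley [] [] as< q

-- The small `z` behind `xs` completes every ascending pair of `xs` to a 231. It will be the last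
-- run minimum.
avoids231⇒descending : ∀ {z as} xs → Unique xs → All (z <_) xs → ¬ Contains231 (xs ++ z ∷ as) →
                       AllPairs _>_ xs
avoids231⇒descending []       _          _           _      = []
avoids231⇒descending {z} {as} (x ∷ xs) (x≢ ∷ un) (z<x ∷ z<xs) avoids =
  All.tabulate x> ∷ avoids231⇒descending xs un z<xs (avoids ∘ contains231-⊆ (skip x ⊆-refl))
  where
  x> : ∀ {y} → y ∈ xs → x > y
  x> {y} y∈ with <-cmp x y
  ... | tri< x<y _ _ = contradiction (231-at z<x x<y (refl ∷ ++⁺ (from∈ y∈) (refl ∷ minimum as))) avoids
  ... | tri≈ _ x≡y _ = contradiction x≡y (All.lookup x≢ y∈)
  ... | tri> _ _ y<x = y<x

-- The last run minimum is the smallest one and leads the reversed minima. The bound `z < p` carries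
-- the induction from one run to the previous.
last-start : ∀ {p m d rs} → Canonical p ((m , d) ∷ rs) →
             ∃[ z ] ∃[ as ] reverse (m ∷ starts rs) ≡ z ∷ as × All (z <_) (d ++ others rs) × z < p
last-start {m = m} (run m<p m<d _ []) = m , [] , refl , Allₚ.++⁺ m<d [] , m<p
last-start {m = m} {rs = rs@(_ ∷ _)} (run m<p m<d _ c@(run _ _ _ _)) with z , as , eq , z< , z<m ← last-start c
  = z , as ∷ʳ m , trans (unfold-reverse m (starts rs)) (cong (_∷ʳ m) eq)
  , Allₚ.++⁺ (All.map (<-trans z<m) m<d) z< , <-trans z<m m<p

others-descending : ∀ {p rs} → Canonical p rs → Unique (others rs) →
                    ¬ Contains231 (others rs ++ reverse (starts rs)) → AllPairs _>_ (others rs)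
others-descending {rs = []}     _ _  _ = []
others-descending {rs = rs@(_ ∷ _)} c un avoids with z , as , eq , z< , _ ← last-start c
  = avoids231⇒descending (others rs) un z<
      (avoids ∘ subst (λ s → Contains231 (others rs ++ s)) (sym eq))

starts-ascending : ∀ {p rs} → Canonical p rs → AllPairs _<_ (reverse (starts rs))
starts-ascending [] = []
starts-ascending {rs = (m , _) ∷ rs} (run _ _ _ c) =
  subst (AllPairs _<_) (sym (unfold-reverse m (starts rs)))
    (AllPairsₚ.++⁺ (starts-ascending c) ([] ∷ [])
      (All.map (_∷ []) (All-resp-↭ (↭-sym (↭-reverse (starts rs))) (starts-< c))))

-- The worker of ascRuns is local to Defs.  On an input 0 ∷ suc y ∷ ys it takes
-- one step; abstracting its arguments there lets unification recover it.
mutual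
  ascRunsFrom : ℕ → List ℕ → List ℕ → List (List ℕ)
  ascRunsFrom = _

  ascRunsFrom-recovered : ∀ y ys → ascRuns (0 ∷ suc y ∷ ys) ≡ ascRunsFrom (suc y) (0 ∷ []) ys
  ascRunsFrom-recovered y ys with suc y | [ 0 ]
  ... | c | acc = refl

-- Joins the worker's current entry and accumulator into one list, the current run backwards, so
-- that `d ∷ʳ m` covers both empty and non-empty `d`.
ascRunsOn : List ℕ → List ℕ → List (List ℕ)
ascRunsOn []        i = []
ascRunsOn (c ∷ acc) i = ascRunsFrom c acc i

ascRunsOn-run : ∀ d {m} i → AllPairs _>_ d → All (m <_) d →
                ascRuns (m ∷ reverse d ++ i) ≡ ascRunsOn (d ∷ʳ m) i
ascRunsOn-run []      i _ _ = refl
ascRunsOn-run (x ∷ d) {m} i (x> ∷ d>) (m<x ∷ m<d) =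
  trans (cong (λ j → ascRuns (m ∷ j)) (reverse-++-∷ x d i))
    (trans (ascRunsOn-run d (x ∷ i) d> m<d) (extend d x>))
  where
  extend : ∀ d → All (_< x) d → ascRunsOn (d ∷ʳ m) (x ∷ i) ≡ ascRunsOn (x ∷ d ∷ʳ m) i
  extend []      _         rewrite <ᵇ-true m<x = refl
  extend (y ∷ d) (y<x ∷ _) rewrite <ᵇ-true y<x = refl

ascRuns-flatten : ∀ {p rs} → Canonical p rs → ascRuns (flatten rs) ≡ toLists rs
ascRuns-flatten [] = refl
ascRuns-flatten {rs = (m , d) ∷ rs} (run _ m<d d> c) =
  trans (ascRunsOn-run d (flatten rs) d> m<d) (trans (close d m<d c) (cong₂ _∷_ (reverse-++ d (m ∷ [])) (ascRuns-flatten c)))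
  where
  close : ∀ d → All (m <_) d → ∀ {rs} → Canonical m rs →
          ascRunsOn (d ∷ʳ m) (flatten rs) ≡ reverse (d ∷ʳ m) ∷ ascRuns (flatten rs)
  close []      _         []              = refl
  close (_ ∷ _) _         []              = refl
  close []      _         (run a<m _ _ _) rewrite <ᵇ-false (<⇒≤ a<m) = refl
  close (_ ∷ _) (m<y ∷ _) (run a<m _ _ _) rewrite <ᵇ-false (<⇒≤ (<-trans a<m m<y)) = refl

-- The Boolean permutation test as rearrangement of `countdown n`

elemᵇ-sound : ∀ x ys → T (not (elemᵇ x ys)) → All (x ≢_) ys
elemᵇ-sound x []       _ = []
elemᵇ-sound x (y ∷ ys) p with x ≡ᵇ y in eq
... | false = (λ x≡y → subst T eq (≡⇒≡ᵇ x y x≡y)) ∷ elemᵇ-sound x ys p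

elemᵇ-complete : ∀ {x ys} → All (x ≢_) ys → T (not (elemᵇ x ys))
elemᵇ-complete [] = _
elemᵇ-complete {x} {y ∷ ys} (x≢y ∷ ps) with x ≡ᵇ y in eq
... | false = elemᵇ-complete ps
... | true  = x≢y (≡ᵇ⇒≡ x y (subst T (sym eq) _))

distinctᵇ-sound : ∀ xs → T (distinctᵇ xs) → Unique xs
distinctᵇ-sound []       _ = []
distinctᵇ-sound (x ∷ xs) p with q , r ← T-∧⁻ p = elemᵇ-sound x xs q ∷ distinctᵇ-sound xs r

distinctᵇ-complete : ∀ {xs} → Unique xs → T (distinctᵇ xs)
distinctᵇ-complete []       = _
distinctᵇ-complete (p ∷ ps) = T-∧⁺ (elemᵇ-complete p) (distinctᵇ-complete ps)

length-countdown : ∀ n → length (countdown n) ≡ n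
length-countdown zero    = refl
length-countdown (suc n) = cong suc (length-countdown n)

countdown-complete : ∀ {n x} → 0 < x → x ≤ n → x ∈ countdown n
countdown-complete {zero}  (s≤s _) ()
countdown-complete {suc n} 0<x x≤1+n with m≤n⇒m<n∨m≡n x≤1+n
... | inj₁ (s≤s x≤n) = there (countdown-complete 0<x x≤n)
... | inj₂ refl      = here refl

countdown-descending : ∀ n → AllPairs _>_ (countdown n)
countdown-descending zero    = []
countdown-descending (suc n) = All.tabulate (s≤s ∘ countdown-≤) ∷ countdown-descending n

Unique-resp-↭ : ∀ {xs ys : List ℕ} → xs ↭ ys → Unique xs → Unique ys
Unique-resp-↭ p = Permutationₛ.Unique-resp-↭ (setoid ℕ) (↭⇒↭ₛ p)

-- Pigeonhole: remove the head `x` of `xs` from `ys`; by distinctness the other entries of `xs` are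
-- still found in what is left.
Unique-⊆⇒↭ : ∀ {xs ys : List ℕ} → Unique xs → (∀ {x} → x ∈ xs → x ∈ ys) → length ys ≤ length xs → xs ↭ ys
Unique-⊆⇒↭ {[]}     {[]} _          _   _ = ↭-refl
Unique-⊆⇒↭ {x ∷ xs} (x≢ ∷ un) sub len with as , bs , refl ← ∈-∃++ (sub (here refl)) =
  ↭-trans (prep x (Unique-⊆⇒↭ un sub′ (≤-pred (≤-trans (≤-reflexive (↭-length (↭-sym x∷))) len)))) (↭-sym x∷)
  where
  x∷ = shift x as bs
  sub′ : ∀ {y} → y ∈ xs → y ∈ as ++ bs
  sub′ y∈ with ∈-resp-↭ x∷ (sub (there y∈))
  ... | here refl = contradiction refl (All.lookup x≢ y∈)
  ... | there y∈′ = y∈′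

isPerm⇒↭ : ∀ n π → T (isPermᵇ n π) → π ↭ countdown n
isPerm⇒↭ n π p with len , q ← T-∧⁻ {length π ≡ᵇ n} p
  with range , distinct ← T-∧⁻ {all (λ x → (0 <ᵇ x) ∧ (x <ᵇ suc n)) π} q
  = Unique-⊆⇒↭ (distinctᵇ-sound π distinct)
      (λ {x} x∈ → let 0<x , x≤n = T-∧⁻ {0 <ᵇ x} (All.lookup (Allₚ.all⁺ _ π range) x∈) in
                  countdown-complete (<ᵇ⇒< 0 x 0<x) (≤-pred (<ᵇ⇒< x (suc n) x≤n)))
      (≤-reflexive (trans (length-countdown n) (sym (≡ᵇ⇒≡ (length π) n len))))

↭⇒isPerm : ∀ {n π} → π ↭ countdown n → T (isPermᵇ n π)
↭⇒isPerm {n} {π} p = T-∧⁺ {length π ≡ᵇ n} (≡⇒≡ᵇ _ n (trans (↭-length p) (length-countdown n)))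
  (T-∧⁺ (Allₚ.all⁻ _ (All-resp-↭ (↭-sym p) (range n ≤-refl)))
        (distinctᵇ-complete (Unique-resp-↭ (↭-sym p) (AllPairs.map >⇒≢ (countdown-descending n)))))
  where
  range : ∀ k → k ≤ n → All (λ x → T ((0 <ᵇ x) ∧ (x <ᵇ suc n))) (countdown k)
  range zero    _   = []
  range (suc k) k<n = <⇒<ᵇ k<n ∷ range k (<⇒≤ k<n)

T-not⁻ : ∀ {b} → T (not b) → ¬ T b
T-not⁻ {false} _ ()

T-not⁺ : ∀ {b} → ¬ T b → T (not b)
T-not⁺ {false} _ = _
T-not⁺ {true}  p = p _

-- The bijection

sort⇒reading : ∀ m π → T (inSortᵇ (suc m) π) → ∃[ rs ] ∃[ w ] π ≡ flatten rs × AfterU m [] rs w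
sort⇒reading m π p with T-∧⁻ {isPermᵇ (suc m) π} p
sort⇒reading m []      p | () , _
sort⇒reading m (x ∷ π) p | perm , avoids
  -- The first entry is pushed on the empty stack, so parsing starts at `x` with `d` and `ms` empty.
  = read (scRun-parse π [] [] [] [] [] refl refl (AllPairs.tail un)
      (All.map (λ x≢y → λ { (here y≡x) → x≢y (sym y≡x) }) (AllPairs.head un))
      (avoids′ ∘ subst Contains231 (sym (SC132≡scRun (x ∷ π)))))
  where
  x∷π↭ = isPerm⇒↭ (suc m) (x ∷ π) perm

  un : Unique (x ∷ π)
  un = Unique-resp-↭ (↭-sym x∷π↭) (AllPairs.map >⇒≢ (countdown-descending (suc m)))

  avoids′ : ¬ Contains231 (SC132 (x ∷ π))
  avoids′ = T-not⁻ avoids ∘ contains231-complete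

  read : Parse x [] π → ∃[ rs ] ∃[ w ] x ∷ π ≡ flatten rs × AfterU m [] rs w
  read (parse d rest refl d> x<d c) =
    let w , r = canonical-AfterU m [] rs canon os x∷π↭ (countdown-descending (suc m)) in rs , w , refl , r
    where
    rs = (x , d) ∷ rest

    canon : Canonical (2 + m) rs
    canon = run (s≤s (countdown-≤ (∈-resp-↭ x∷π↭ (here refl)))) x<d d> c

    os : AllPairs _>_ (others rs)
    os = others-descending canon
      (AllPairs-resp-⊆ (++⁺ˡ (starts rs) ⊆-refl) (Unique-resp-↭ (flatten-↭ rs) un))
      (avoids′ ∘ subst Contains231 (sym (SC132-flatten canon)))

reading-canonical : ∀ {m rs w} → AfterU m [] rs w → Canonical (2 + m) rs
reading-canonical {m} r = AfterU-canonical r (countdown-descending (suc m))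

reading⇒sort : ∀ {m rs w} → AfterU m [] rs w → T (inSortᵇ (suc m) (flatten rs))
reading⇒sort {m} {rs} r = T-∧⁺ (↭⇒isPerm (AfterU-↭ r)) (T-not⁺ λ p →
  contains231-valley (others rs)
    (AllPairs-resp-⊆ (AfterU-others r) (countdown-descending (suc m)))
    (starts-ascending (reading-canonical r))
    (subst (T ∘ contains231ᵇ) (SC132-flatten (reading-canonical r)) p))

reading⇒dyck : ∀ {m rs w} → AfterU m [] rs w → T (isDyckᵇ (suc m) (U ∷ w))
reading⇒dyck {m} {w = w} r with p , eq ← AfterU-dyck r = T-∧⁺ p (≡⇒≡ᵇ (countU w) m eq)

reading⇒Φ : ∀ {m rs w} → AfterU m [] rs w → Φ (suc m) (flatten rs) ≡ just (U ∷ w)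
reading⇒Φ {m} r = trans (cong (ΦRuns (2 + m)) (ascRuns-flatten (reading-canonical r))) (AfterU-Φ r 1)

-- Taken from the reading, since `Φ` only returns a `Maybe`. The leading `U`, which introduces
-- `suc m`, counts as read before `w` begins.
toDyck : ∀ m → SortSC132 (suc m) → DyckPaths (suc m)
toDyck m (π , p) with rs , w , _ , r ← sort⇒reading m π p = U ∷ w , reading⇒dyck r

toDyck-Φ : ∀ m p → Φ (suc m) (proj₁ p) ≡ just (proj₁ (toDyck m p))
toDyck-Φ m (π , p) with rs , w , refl , r ← sort⇒reading m π p = reading⇒Φ r

toDyck-injective : ∀ m {p q} → toDyck m p ≡ toDyck m q → p ≡ q
toDyck-injective m {π , p} {ρ , q} eq
  with rs , w , refl , r ← sort⇒reading m π p | rs′ , w′ , refl , r′ ← sort⇒reading m ρ q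
  with refl ← cong proj₁ eq = Σ-T-≡ (cong flatten (AfterU-deterministic r r′))

toDyck-surjective : ∀ m (v : DyckPaths (suc m)) → ∃[ p ] toDyck m p ≡ v
toDyck-surjective m (U ∷ w , p) with dyck , count ← T-∧⁻ {dyckFromᵇ 1 w} p
  with rs , r ← dyck-AfterU m [] w dyck (≡ᵇ⇒≡ (countU w) m count)
  -- The reading that `toDyck` finds for `s` need not be `r` itself, but both words are the value of
  -- `Φ`.
  = s , Σ-T-≡ (just-injective (trans (sym (toDyck-Φ m s)) (reading⇒Φ r)))
  where s = flatten rs , reading⇒sort r

theorem4p4 : (n : ℕ) → 1 ≤ n →
    Σ[ f ∈ (SortSC132 n → DyckPaths n) ]
      ((∀ p → Φ n (proj₁ p) ≡ just (proj₁ (f p)))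
        × Bijective _≡_ _≡_ f)
    × (SortSC132 n ↔ Fin (catalan n))
theorem4p4 (suc m) _ = toDyck m , (toDyck-Φ m , bijective) , Dyck↔Fin (suc m) ↔-∘ ⤖⇒↔ (mk⤖ bijective)
  where
  bijective : Bijective _≡_ _≡_ (toDyck m)
  bijective = toDyck-injective m , λ v →
    let p , eq = toDyck-surjective m v in p , λ { refl → eq }
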